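{- Suppose that for every numerical semigroup $S\ne\mathbb{N}$ with $t(S)\ge e(S)$, writing $\mathrm{PF}(S)=\{f_1<\dots<f_{t}\}$ with $t=t(S)$ and $d=t(S)+1-e(S)$, one has $$\Theta(S)\;\ge\;\sum_{i=1}^{d}\lambda_S(f_i).$$ Then for every numerical semigroup $S\neq\mathbb{N}$ one has $e(S)\,n(S)\ge c(S)$ (Wilf's conjecture).
   Context: $\mathbb{N}=\{0,1,2,\dots\}$. A numerical semigroup is a submonoid $S\subseteq\mathbb{N}$ (under addition) with finite complement $G(S)=\mathbb{N}\setminus S$, whose elements are the gaps. Let $S\ne\mathbb{N}$. $F=\max G(S)$, $c(S)=F+1$, $n(S)=|S\cap[0,c(S))|$, and $e(S)$ is the cardinality of the unique minimal system of generators of $S$. An integer $f$ is a pseudo-Frobenius number if $f\notin S$ and $f+s\in S$ for all $s\in S\setminus\{0\}$; $\mathrm{PF}(S)$ is the set of these and $t(S)=|\mathrm{PF}(S)|$. For $y\in\mathbb{Z}$, $\lambda_S(y)=|S\cap[0,y]|$; for an integer $x\in[1,F]$, $\nu_S(x)=|\{f\in\mathrm{PF}(S): f-x\in S\}|$; and $\Theta(S)=\sum_{x\in G(S)}(\nu_S(x)-1)$. -}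

module Defs where

open import Data.Nat.Base as ℕ using (ℕ; zero; suc; _+_; _∸_; _≤_; _<_; z≤n; s≤s)
open import Data.Nat.Properties
open import Data.Nat.Induction using (<-rec)
open import Data.Integer.Base as ℤ using (ℤ; +_; -[1+_]; 0ℤ; 1ℤ; -1ℤ)
import Data.Integer.Properties as ℤₚ
open import Data.List.Base using (List; []; _∷_; _++_; length; map; filter; foldr; upTo)
open import Data.List.Extrema.Nat using (max; xs≤max; argmax-sel)
open import Data.Nat.ListAction using (sum)
open import Data.Nat.ListAction.Properties using (sum-++)
open import Data.List.Membership.Propositional using () renaming (_∈_ to _∈ₗ_)
open import Data.List.Membership.Propositional.Properties
  using (∈-filter⁺; ∈-filter⁻; ∈-map⁺; ∈-upTo⁺)
open import Data.List.Relation.Unary.All as All using (All; []; _∷_)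
import Data.List.Relation.Unary.All.Properties as Allₚ
open import Data.List.Relation.Unary.Any using (here; there)
open import Data.List.Relation.Unary.AllPairs using (AllPairs; _∷_)
import Data.List.Relation.Unary.AllPairs.Properties as AllPairsₚ
open import Data.List.Relation.Unary.Unique.Propositional using (Unique)
import Data.List.Relation.Unary.Unique.Propositional.Properties as Uniqueₚ
open import Data.Product.Base using (∃; _×_; _,_; proj₁; proj₂)
open import Data.Sum.Base using (inj₁; inj₂)
open import Data.Empty using (⊥; ⊥-elim)
open import Function.Base using (id)
open import Function.Bundles using (_⇔_; mk⇔; Equivalence)
open import Level using (0ℓ)
open import Relation.Nullary.Decidable
  using (Dec; yes; no; ¬?; _×-dec_; _→-dec_; map′)
open import Relation.Nullary.Negation using (¬_; contradiction)
open import Relation.Unary using (Pred; Decidable; _∈_; _∉_; _⊆_; _≐_)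
open import Relation.Binary.PropositionalEquality

-- Finite sets are listed without repetition, so that their cardinality is the
-- length of the list.  Decidability of membership, classically automatic, is
-- part of the data.

record NumericalSemigroup : Set₁ where
  field
    Carrier  : Pred ℕ 0ℓ
    _∈?      : Decidable Carrier
    0∈       : 0 ∈ Carrier
    +-closed : ∀ {x y} → x ∈ Carrier → y ∈ Carrier → x + y ∈ Carrier
    gaps     : List ℕ
    gaps-!   : Unique gaps
    ∈gaps⇔   : ∀ x → x ∈ₗ gaps ⇔ x ∉ Carrier

open NumericalSemigroup public using (Carrier; gaps)

_≠ℕ : NumericalSemigroup → Set
S ≠ℕ = ¬ (∀ x → x ∈ Carrier S)

-- The default value 0 of the maximum matters only for S = ℕ, which has no gaps.
F : NumericalSemigroup → ℕ
F S = max 0 (gaps S)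

c : NumericalSemigroup → ℕ
c S = F S + 1

n : NumericalSemigroup → ℕ
n S = length (filter (NumericalSemigroup._∈? S) (upTo (c S)))

module _ (S : NumericalSemigroup) where
  open NumericalSemigroup S using (_∈?; 0∈; ∈gaps⇔)

  c≤⇒∈ : ∀ {x} → c S ≤ x → x ∈ Carrier S
  c≤⇒∈ {x} c≤x with x ∈?
  ... | yes x∈ = x∈
  ... | no  x∉ = contradiction
    (All.lookup (xs≤max 0 (gaps S)) (Equivalence.from (∈gaps⇔ x) x∉))
    (<⇒≱ (subst (_≤ x) (+-comm (F S) 1) c≤x))

  F∉ : ∀ {x} → x ∉ Carrier S → F S ∉ Carrier S
  F∉ {x} x∉ with argmax-sel id 0 (gaps S)
  ... | inj₂ F∈gaps = Equivalence.to (∈gaps⇔ _) F∈gaps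
  ... | inj₁ F≡0    = ⊥-elim (x∉ (subst (_∈ Carrier S) (sym x≡0) 0∈))
    where
    x≡0 : x ≡ 0
    x≡0 = n≤0⇒n≡0 (subst (x ≤_) F≡0
      (All.lookup (xs≤max 0 (gaps S)) (Equivalence.from (∈gaps⇔ x) x∉)))

-- The submonoid of ℕ generated by A: all finite sums of elements of A.
⟨_⟩ : Pred ℕ 0ℓ → Pred ℕ 0ℓ
⟨ A ⟩ x = ∃ λ xs → All A xs × sum xs ≡ x

_Generates_ : Pred ℕ 0ℓ → NumericalSemigroup → Set
A Generates S = ⟨ A ⟩ ≐ Carrier S

_MinimallyGenerates_ : Pred ℕ 0ℓ → NumericalSemigroup → Set₁
A MinimallyGenerates S =
  A Generates S × (∀ (B : Pred ℕ 0ℓ) → B ⊆ A → B Generates S → A ⊆ B)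

module _ (S : NumericalSemigroup) where
  open NumericalSemigroup S using (_∈?; +-closed)

  private
    -- x is a sum of two nonzero elements y and x ∸ y of S.
    Decomposable : Pred ℕ 0ℓ
    Decomposable x =
      ∃ λ y → y < x × (y ∈ Carrier S × y ≢ 0 × x ∸ y ∈ Carrier S)

    Atom : Pred ℕ 0ℓ
    Atom x = x ∈ Carrier S × x ≢ 0 × ¬ Decomposable x

    decomposable? : Decidable Decomposable
    decomposable? x =
      anyUpTo? (λ y → y ∈? ×-dec ¬? (y ≟ 0) ×-dec (x ∸ y) ∈?) x

    atom? : Decidable Atom
    atom? x = x ∈? ×-dec ¬? (x ≟ 0) ×-dec ¬? (decomposable? x)

    0<c : 0 < c S
    0<c = subst (0 <_) (+-comm 1 (F S)) ℕ.z<s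

    large-decomposable : ∀ {x} → c S + c S ≤ x → Decomposable x
    large-decomposable {x} 2c≤x =
      c S , <-≤-trans (m<m+n (c S) 0<c) 2c≤x ,
      c≤⇒∈ S ≤-refl , (λ c≡0 → <⇒≢ 0<c (sym c≡0)) ,
      c≤⇒∈ S (m+n≤o⇒m≤o∸n (c S) 2c≤x)

    atoms : List ℕ
    atoms = filter atom? (upTo (c S + c S))

    atom⇒∈atoms : ∀ {x} → Atom x → x ∈ₗ atoms
    atom⇒∈atoms a@(_ , _ , indec) =
      ∈-filter⁺ atom? (∈-upTo⁺ (≰⇒> λ 2c≤x → indec (large-decomposable 2c≤x))) a

    ∈atoms⇒atom : ∀ {x} → x ∈ₗ atoms → Atom x
    ∈atoms⇒atom x∈ = proj₂ (∈-filter⁻ atom? {xs = upTo (c S + c S)} x∈)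

    ⟨⟩-closed : ∀ {A x y} → x ∈ ⟨ A ⟩ → y ∈ ⟨ A ⟩ → x + y ∈ ⟨ A ⟩
    ⟨⟩-closed (xs , Axs , refl) (ys , Ays , refl) =
      xs ++ ys , Allₚ.++⁺ Axs Ays , sum-++ xs ys

    sums∈ : ∀ xs → All (_∈ₗ atoms) xs → sum xs ∈ Carrier S
    sums∈ []       []         = NumericalSemigroup.0∈ S
    sums∈ (x ∷ xs) (x∈ ∷ xs∈) = +-closed (proj₁ (∈atoms⇒atom x∈)) (sums∈ xs xs∈)

    ∈⇒∈⟨atoms⟩ : ∀ x → x ∈ Carrier S → x ∈ ⟨ _∈ₗ atoms ⟩
    ∈⇒∈⟨atoms⟩ = <-rec _ step
      where
      step : ∀ x → (∀ {y} → y < x → y ∈ Carrier S → y ∈ ⟨ _∈ₗ atoms ⟩) →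
             x ∈ Carrier S → x ∈ ⟨ _∈ₗ atoms ⟩
      step x rec x∈ with x ≟ 0 | decomposable? x
      ... | yes refl | _ = [] , [] , refl
      ... | no x≢0 | no indec =
        x ∷ [] , atom⇒∈atoms (x∈ , x≢0 , indec) ∷ [] , +-identityʳ x
      ... | no x≢0 | yes (y , y<x , y∈ , y≢0 , x∸y∈) =
        subst (_∈ ⟨ _∈ₗ atoms ⟩) (m+[n∸m]≡n (<⇒≤ y<x))
          (⟨⟩-closed (rec y<x y∈)
            (rec (∸-monoʳ-< (n≢0⇒n>0 y≢0) (<⇒≤ y<x)) x∸y∈))

    atoms-generate : (_∈ₗ atoms) Generates S
    atoms-generate = (λ { (xs , xs∈ , refl) → sums∈ xs xs∈ }) , λ {x} → ∈⇒∈⟨atoms⟩ x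

    atoms⊆ : ∀ B → B Generates S → (_∈ₗ atoms) ⊆ B
    atoms⊆ B (⟨B⟩⊆S , S⊆⟨B⟩) {a} a∈ with ∈atoms⇒atom a∈
    ... | a∈S , a≢0 , indec with S⊆⟨B⟩ a∈S
    ... | xs , Bxs , eq = go xs Bxs eq
      where
      go : ∀ xs → All B xs → sum xs ≡ a → B a
      go [] [] 0≡a = contradiction (sym 0≡a) a≢0
      go (b ∷ bs) (Bb ∷ Bbs) eq with b ≟ 0 | sum bs ≟ 0
      ... | yes refl | _ = go bs Bbs eq
      ... | no _ | yes s≡0 =
        subst B (trans (sym (+-identityʳ b)) (trans (cong (λ z → b + z) (sym s≡0)) eq)) Bb
      ... | no b≢0 | no s≢0 = contradiction
        ( b
        , subst (b <_) eq (m<m+n b (n≢0⇒n>0 s≢0))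
        , ⟨B⟩⊆S (b ∷ [] , Bb ∷ [] , +-identityʳ b)
        , b≢0
        , subst (_∈ Carrier S) (trans (sym (m+n∸m≡n b (sum bs))) (cong (_∸ b) eq))
            (⟨B⟩⊆S (bs , Bbs , refl)) )
        indec

  minimalGenerators :
    ∃ λ (A : List ℕ) → Unique A × (_∈ₗ A) MinimallyGenerates S
  minimalGenerators =
    atoms , Uniqueₚ.filter⁺ atom? (Uniqueₚ.upTo⁺ (c S + c S)) ,
    atoms-generate , λ B _ → atoms⊆ B

  minimalGenerators-unique :
    ∀ A → A MinimallyGenerates S → A ≐ (_∈ₗ proj₁ minimalGenerators)
  minimalGenerators-unique A (gen , min) =
    min (_∈ₗ atoms) (atoms⊆ A gen) atoms-generate , atoms⊆ A gen

e : NumericalSemigroup → ℕ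
e S = length (proj₁ (minimalGenerators S))

Carrierℤ : NumericalSemigroup → Pred ℤ 0ℓ
Carrierℤ S (+ m)    = m ∈ Carrier S
Carrierℤ S -[1+ m ] = ⊥

_∈ℤ?_ : ∀ x S → Dec (x ∈ Carrierℤ S)
(+ m)    ∈ℤ? S = NumericalSemigroup._∈? S m
-[1+ m ] ∈ℤ? S = no λ ()

PseudoFrobenius : NumericalSemigroup → Pred ℤ 0ℓ
PseudoFrobenius S f =
  f ∉ Carrierℤ S × (∀ s → s ∈ Carrier S → s ≢ 0 → f ℤ.+ + s ∈ Carrierℤ S)

module _ (S : NumericalSemigroup) where
  open NumericalSemigroup S using (_∈?)

  private
    large-shift∈ : ∀ f {s} → c S + ℤ.∣ f ∣ ≤ s → f ℤ.+ + s ∈ Carrierℤ S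
    large-shift∈ (+ m) {s} le =
      c≤⇒∈ S (≤-trans (m+n≤o⇒m≤o (c S) le) (m≤n+m s m))
    large-shift∈ -[1+ m ] {s} le
      rewrite ℤₚ.⊖-≥ {s} {suc m} (m+n≤o⇒n≤o (c S) le) =
      c≤⇒∈ S (m+n≤o⇒m≤o∸n (c S) le)

    pseudoFrobenius? : Decidable (PseudoFrobenius S)
    pseudoFrobenius? f = ¬? (f ∈ℤ? S) ×-dec map′ to from
      (allUpTo? (λ s → s ∈? →-dec ¬? (s ≟ 0) →-dec ((f ℤ.+ + s) ∈ℤ? S)) bound)
      where
      bound : ℕ
      bound = c S + ℤ.∣ f ∣
      P : Pred ℕ 0ℓ
      P s = s ∈ Carrier S → s ≢ 0 → f ℤ.+ + s ∈ Carrierℤ S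
      to : (∀ {s} → s < bound → P s) → ∀ s → P s
      to h s with s <? bound
      ... | yes s<b = h s<b
      ... | no  s≮b = λ _ _ → large-shift∈ f (≮⇒≥ s≮b)
      from : (∀ s → P s) → ∀ {s} → s < bound → P s
      from h {s} _ = h s

    candidates : List ℤ
    candidates = -1ℤ ∷ map +_ (upTo (c S))

    candidates-< : AllPairs ℤ._<_ candidates
    candidates-< =
      Allₚ.map⁺ (All.universal (λ _ → ℤ.-<+) _) ∷
      AllPairsₚ.map⁺ (AllPairsₚ.applyUpTo⁺₁ id (c S) (λ i<j _ → ℤ.+<+ i<j))

    pseudoFrobenius⇒candidate : ∀ f → PseudoFrobenius S f → f ∈ₗ candidates
    pseudoFrobenius⇒candidate (+ m) (m∉ , _) =
      there (∈-map⁺ +_ (∈-upTo⁺ (≰⇒> λ c≤m → m∉ (c≤⇒∈ S c≤m))))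
    pseudoFrobenius⇒candidate -[1+ zero ] _ = here refl
    pseudoFrobenius⇒candidate -[1+ suc m ] (_ , shift) with 1 ∈?
    ... | yes 1∈ = ⊥-elim (shift 1 1∈ λ ())
    ... | no  1∉ = ⊥-elim (F∉ S 1∉ F∈)
      where
      s : ℕ
      s = F S + suc (suc m)
      s∈ : s ∈ Carrier S
      s∈ = c≤⇒∈ S (+-monoʳ-≤ (F S) (s≤s z≤n))
      s≢0 : s ≢ 0
      s≢0 s≡0 with m+n≡0⇒n≡0 (F S) s≡0
      ... | ()
      shift≡F : -[1+ suc m ] ℤ.+ + s ≡ + F S
      shift≡F = trans (ℤₚ.⊖-≥ (m≤n+m (suc (suc m)) (F S)))
                      (cong +_ (m+n∸n≡m (F S) (suc (suc m))))
      F∈ : F S ∈ Carrier S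
      F∈ = subst (_∈ Carrierℤ S) shift≡F (shift s s∈ s≢0)

  pseudoFrobenius :
    ∃ λ (fs : List ℤ) →
      AllPairs ℤ._<_ fs × (∀ f → f ∈ₗ fs ⇔ f ∈ PseudoFrobenius S)
  pseudoFrobenius =
    filter pseudoFrobenius? candidates ,
    AllPairsₚ.filter⁺ pseudoFrobenius? candidates-< ,
    λ f → mk⇔
      (λ f∈ → proj₂ (∈-filter⁻ pseudoFrobenius? {xs = candidates} f∈))
      (λ pf → ∈-filter⁺ pseudoFrobenius? (pseudoFrobenius⇒candidate f pf) pf)

-- The increasing enumeration f₁ < ⋯ < fₜ.
PF : NumericalSemigroup → List ℤ
PF S = proj₁ (pseudoFrobenius S)

t : NumericalSemigroup → ℕ
t S = length (PF S)

-- λ_S(y) = |S ∩ [0,y]|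
Λ : NumericalSemigroup → ℤ → ℕ
Λ S (+ m)    = length (filter (NumericalSemigroup._∈? S) (upTo (suc m)))
Λ S -[1+ m ] = 0

ν : NumericalSemigroup → ℤ → ℕ
ν S x = length (filter (λ f → (f ℤ.- x) ∈ℤ? S) (PF S))

sumℤ : List ℤ → ℤ
sumℤ = foldr ℤ._+_ 0ℤ

Θ : NumericalSemigroup → ℤ
Θ S = sumℤ (map (λ x → + ν S (+ x) ℤ.- 1ℤ) (gaps S))

{-# OPTIONS --safe #-}

-- Write G for the set of gaps.  A gap x with f − x = k ∈ S is the same thing as
-- an element k of S below f, so exchanging the order of summation gives
-- Σ_{x ∈ G} ν(x) ≤ Σ_{f ∈ PF} λ(f).  Every λ(f) is at most n, since f ≤ F.
-- Also ν ≥ 1 on G: add nonzero elements of S to a gap x for as long as the sum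
-- remains a gap; this stops at some f ∈ PF with f − x ∈ S.
-- If t < e, then |G| ≤ Σ ν ≤ t n ≤ (e − 1) n.
-- If t ≥ e, the hypothesis cancels the d smallest λ(fᵢ) and leaves the
-- t − d = e − 1 others, so again |G| ≤ (e − 1) n.
-- In both cases c = n + |G| ≤ e n.
module Submission where

open import Defs
open import Data.Nat.Base using (ℕ; _+_; _*_; _∸_; _≥_; zero; suc; _≤_; _<_; z≤n; s≤s)
open import Data.Nat.Properties
import Data.Integer.Base as ℤ
import Data.Integer.Properties as ℤₚ
open import Data.List.Base using (map; take; List; []; _∷_; length; filter; drop; upTo; _++_)
open import Data.List.Properties
  using (length-map; length-upTo; length-drop; filter-notAll; filter-some; map-++; take++drop≡id)
open import Data.List.Membership.Propositional using (lose) renaming (_∈_ to _∈ₗ_)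
open import Data.List.Membership.Propositional.Properties
  using (∈-filter⁺; ∈-filter⁻; ∈-map⁺; ∈-upTo⁺; ∈-upTo⁻; ∈-length)
open import Data.List.Relation.Unary.All as All using (All; []; _∷_)
import Data.List.Relation.Unary.All.Properties as Allₚ
import Data.List.Relation.Unary.Any as Any
open import Data.List.Relation.Unary.AllPairs using ([]; _∷_)
open import Data.List.Relation.Unary.Unique.Propositional using (Unique)
import Data.List.Relation.Unary.Unique.Propositional.Properties as Uniqueₚ
open import Data.Nat.ListAction using (sum)
open import Data.Nat.ListAction.Properties using (sum-++)
open import Data.Product.Base using (∃; _×_; _,_; proj₁; proj₂)
open import Data.Bool.Base using (true; false)
open import Function.Bundles using (Equivalence)
open import Relation.Nullary.Decidable using (Dec; yes; no; does; ¬?; _×-dec_)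
open import Relation.Nullary.Negation using (contradiction)
open import Relation.Unary using (Decidable; _∈_; _∉_)
open import Relation.Binary.Definitions using (DecidableEquality)
open import Relation.Binary.PropositionalEquality
open import Algebra.Properties.AbelianGroup ℤₚ.+-0-abelianGroup
  using (//-rightDividesˡ; //-rightDividesʳ)
open import Algebra.Properties.CommutativeSemigroup +-commutativeSemigroup using (x∙yz≈y∙xz)
open import Algebra.Properties.CommutativeSemigroup ℤₚ.+-commutativeSemigroup using (interchange)

open NumericalSemigroup using (_∈?; 0∈; +-closed; gaps-!; ∈gaps⇔)

module _ {A : Set} (_≟ᴬ_ : DecidableEquality A) where

  -- Deleting `x` from `ys` strictly shortens it, because `x` occurs there. The tail `xs` does not
  -- contain `x`, so it still lies in what remains.
  unique-⊆⇒length≤ : ∀ {xs ys : List A} → Unique xs → (∀ {x} → x ∈ₗ xs → x ∈ₗ ys) →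
                     length xs ≤ length ys
  unique-⊆⇒length≤ []       sub = z≤n
  unique-⊆⇒length≤ {x ∷ xs} {ys} (x∉xs ∷ xs!) sub = ≤-<-trans
    (unique-⊆⇒length≤ xs! λ y∈xs →
      ∈-filter⁺ ≢x? (sub (Any.there y∈xs)) (λ y≡x → All.lookup x∉xs y∈xs (sym y≡x)))
    (filter-notAll ≢x? ys (lose (sub (Any.here refl)) λ x≢x → x≢x refl))
    where
    ≢x? : Decidable (_≢ x)
    ≢x? y = ¬? (y ≟ᴬ x)

length≤filter+filter¬ : ∀ {A : Set} {P : A → Set} (P? : Decidable P) xs →
  length xs ≤ length (filter P? xs) + length (filter (λ x → ¬? (P? x)) xs)
length≤filter+filter¬ P? []       = z≤n
length≤filter+filter¬ P? (x ∷ xs) with ih ← length≤filter+filter¬ P? xs | does (P? x)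
... | true  = s≤s ih
... | false = ≤-trans (s≤s ih) (≤-reflexive (sym (+-suc _ _)))

sum-map-const : ∀ {A : Set} m (xs : List A) → sum (map (λ _ → m) xs) ≡ length xs * m
sum-map-const m []       = refl
sum-map-const m (x ∷ xs) = cong (m +_) (sum-map-const m xs)

sum-map-mono : ∀ {A : Set} {g h : A → ℕ} {xs} → All (λ x → g x ≤ h x) xs →
               sum (map g xs) ≤ sum (map h xs)
sum-map-mono []       = z≤n
sum-map-mono (p ∷ ps) = +-mono-≤ p (sum-map-mono ps)

length≤sum : ∀ {A : Set} {g : A → ℕ} {xs} → All (λ x → 1 ≤ g x) xs →
             length xs ≤ sum (map g xs)
length≤sum {xs = xs} ps = ≤-trans
  (≤-reflexive (sym (trans (sum-map-const 1 xs) (*-identityʳ (length xs)))))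
  (sum-map-mono ps)

sum≤length* : ∀ {A : Set} {g : A → ℕ} {m xs} → All (λ x → g x ≤ m) xs →
              sum (map g xs) ≤ length xs * m
sum≤length* {m = m} {xs} ps = subst (_ ≤_) (sum-map-const m xs) (sum-map-mono ps)

sum-take+drop : ∀ {A : Set} (g : A → ℕ) k xs →
  sum (map g (take k xs)) + sum (map g (drop k xs)) ≡ sum (map g xs)
sum-take+drop g k xs = begin
  sum (map g (take k xs)) + sum (map g (drop k xs))
    ≡⟨ sum-++ (map g (take k xs)) _ ⟨
  sum (map g (take k xs) ++ map g (drop k xs))
    ≡⟨ cong sum (map-++ g (take k xs) _) ⟨
  sum (map g (take k xs ++ drop k xs))
    ≡⟨ cong (λ zs → sum (map g zs)) (take++drop≡id k xs) ⟩
  sum (map g xs) ∎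
  where open ≡-Reasoning

module _ {A B : Set} {R : A → B → Set} (R? : ∀ x y → Dec (R x y)) where

  -- Both sides count the related pairs, by rows and by columns. A new row `x` adds at most one to
  -- each column.
  double-counting : ∀ xs ys →
    sum (map (λ x → length (filter (R? x) ys)) xs) ≡
    sum (map (λ y → length (filter (λ x → R? x y) xs)) ys)
  double-counting []       ys = sym (trans (sum-map-const 0 ys) (*-zeroʳ (length ys)))
  double-counting (x ∷ xs) ys = trans (cong (_ +_) (double-counting xs ys)) (split ys)
    where
    count : List A → B → ℕ
    count zs y = length (filter (λ z → R? z y) zs)
    split : ∀ ys → length (filter (R? x) ys) + sum (map (count xs) ys) ≡
                   sum (map (count (x ∷ xs)) ys)
    split []       = refl
    -- The pair of `x` and `y` adds the same amount to the row of `x` and to the column of `y`, so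
    -- one case split settles both sides.
    split (y ∷ ys) with ih ← trans
        (x∙yz≈y∙xz (length (filter (R? x) ys)) (count xs y) (sum (map (count xs) ys)))
        (cong (count xs y +_) (split ys))
      | does (R? x y)
    ... | true  = cong suc ih
    ... | false = ih

-- For m = t and n = e the left side is t - d, the number of pseudo-Frobenius numbers left after
-- removing the d smallest; it equals e - 1.
m∸[m+1∸n]<n : ∀ {m n} → 0 < n → n ≤ m → m ∸ (m + 1 ∸ n) < n
m∸[m+1∸n]<n {m} {suc k} _ k<m = s≤s (≤-reflexive (begin
  m ∸ (m + 1 ∸ suc k)  ≡⟨ cong (λ z → m ∸ (z ∸ suc k)) (+-comm m 1) ⟩
  m ∸ (m ∸ k)          ≡⟨ m∸[m∸n]≡n (<⇒≤ k<m) ⟩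
  k                    ∎))
  where open ≡-Reasoning

-- `Θ` subtracts 1 for every gap. Adding the number of gaps back gives a sum of natural numbers, so
-- the counting can be done in ℕ.
sumℤ-pred : ∀ (g : ℕ → ℕ) xs →
  sumℤ (map (λ x → ℤ.+ g x ℤ.- ℤ.1ℤ) xs) ℤ.+ ℤ.+ length xs ≡ ℤ.+ sum (map g xs)
sumℤ-pred g []       = refl
sumℤ-pred g (x ∷ xs) = begin
  (a ℤ.- ℤ.1ℤ ℤ.+ s) ℤ.+ (ℤ.1ℤ ℤ.+ l)  ≡⟨ interchange (a ℤ.- ℤ.1ℤ) s ℤ.1ℤ l ⟩
  (a ℤ.- ℤ.1ℤ ℤ.+ ℤ.1ℤ) ℤ.+ (s ℤ.+ l)  ≡⟨ cong₂ ℤ._+_ (//-rightDividesˡ ℤ.1ℤ a) (sumℤ-pred g xs) ⟩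
  ℤ.+ sum (map g (x ∷ xs))              ∎
  where
  open ≡-Reasoning
  a s l : ℤ.ℤ
  a = ℤ.+ g x
  s = sumℤ (map (λ x → ℤ.+ g x ℤ.- ℤ.1ℤ) xs)
  l = ℤ.+ length xs

module _ (S : NumericalSemigroup) where

  -∈Carrierℤ : ∀ f x → (f ℤ.- ℤ.+ x) ∈ Carrierℤ S → ∃ λ k → k ∈ Carrier S × f ≡ ℤ.+ (k + x)
  -∈Carrierℤ f x f-x∈ with f ℤ.- ℤ.+ x in eq
  ... | ℤ.+ k = k , f-x∈ , trans (sym (//-rightDividesˡ (ℤ.+ x) f)) (cong (ℤ._+ ℤ.+ x) eq)

  ∈PF⇒PseudoFrobenius : ∀ {f} → f ∈ₗ PF S → PseudoFrobenius S f
  ∈PF⇒PseudoFrobenius {f} = Equivalence.to (proj₂ (proj₂ (pseudoFrobenius S)) f)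

  -- The map x ↦ f - x is injective and sends these gaps into S ∩ [0,f]. It is its own inverse, so
  -- the gaps are found in the image of S ∩ [0,f] under k ↦ f - k.
  gapsBelow≤Λ : ∀ f → length (filter (λ x → (f ℤ.- ℤ.+ x) ∈ℤ? S) (gaps S)) ≤ Λ S f
  gapsBelow≤Λ f = subst (length below ≤_) (length-image f)
    (unique-⊆⇒length≤ _≟_ (Uniqueₚ.filter⁺ P? (gaps-! S)) below⊆image)
    where
    P? : Decidable (λ x → (f ℤ.- ℤ.+ x) ∈ Carrierℤ S)
    P? x = (f ℤ.- ℤ.+ x) ∈ℤ? S
    below : List ℕ
    below = filter P? (gaps S)
    image : ℤ.ℤ → List ℕ
    image (ℤ.+ m)    = map (m ∸_) (filter (S ∈?) (upTo (suc m)))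
    image ℤ.-[1+ m ] = []
    length-image : ∀ f → length (image f) ≡ Λ S f
    length-image (ℤ.+ m)    = length-map (m ∸_) (filter (S ∈?) (upTo (suc m)))
    length-image ℤ.-[1+ m ] = refl
    below⊆image : ∀ {x} → x ∈ₗ below → x ∈ₗ image f
    below⊆image {x} x∈ with -∈Carrierℤ f x (proj₂ (∈-filter⁻ P? {xs = gaps S} x∈))
    -- Now f = k + x is nonnegative, so `image f` reduces to its first clause, and x is the image of
    -- k.
    ... | k , k∈ , refl = subst (_∈ₗ image f) (m+n∸m≡n k x)
      (∈-map⁺ (k + x ∸_) (∈-filter⁺ (S ∈?) (∈-upTo⁺ (s≤s (m≤m+n k x))) k∈))

  sum-ν≤sum-Λ : sum (map (λ x → ν S (ℤ.+ x)) (gaps S)) ≤ sum (map (Λ S) (PF S))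
  sum-ν≤sum-Λ = begin
    sum (map (λ x → ν S (ℤ.+ x)) (gaps S))
      ≡⟨ double-counting (λ x f → (f ℤ.- ℤ.+ x) ∈ℤ? S) (gaps S) (PF S) ⟩
    sum (map (λ f → length (filter (λ x → (f ℤ.- ℤ.+ x) ∈ℤ? S) (gaps S))) (PF S))
      ≤⟨ sum-map-mono (All.universal gapsBelow≤Λ (PF S)) ⟩
    sum (map (Λ S) (PF S)) ∎
    where open ≤-Reasoning

  Λ≤n : ∀ {f} → f ∉ Carrierℤ S → Λ S f ≤ n S
  Λ≤n {ℤ.-[1+ m ]} _  = z≤n
  Λ≤n {ℤ.+ m}      m∉ = unique-⊆⇒length≤ _≟_
    (Uniqueₚ.filter⁺ (S ∈?) (Uniqueₚ.upTo⁺ (suc m)))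
    λ x∈ → let x∈upTo , x∈S = ∈-filter⁻ (S ∈?) {xs = upTo (suc m)} x∈ in
      ∈-filter⁺ (S ∈?) (∈-upTo⁺ (<-≤-trans (∈-upTo⁻ x∈upTo) m<c)) x∈S
    where
    m<c : m < c S
    m<c = ≰⇒> λ c≤m → m∉ (c≤⇒∈ S c≤m)

  Λ≤n-PF : All (λ f → Λ S f ≤ n S) (PF S)
  Λ≤n-PF = All.tabulate λ {f} f∈ → Λ≤n {f} (proj₁ (∈PF⇒PseudoFrobenius f∈))

  -- d is fuel: each step increases x, which as a gap stays below c.
  gap-below-PF : ∀ d x → c S ≤ d + x → x ∉ Carrier S →
                 ∃ λ k → k ∈ Carrier S × PseudoFrobenius S (ℤ.+ (k + x))
  gap-below-PF zero    x c≤x   x∉ = contradiction (c≤⇒∈ S c≤x) x∉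
  gap-below-PF (suc d) x c≤d+x x∉
    -- For s ≥ c the sum x + s is in S anyway, so a search below c decides whether x is
    -- pseudo-Frobenius.
    with anyUpTo? (λ s → (S ∈?) s ×-dec ¬? (s ≟ 0) ×-dec ¬? ((S ∈?) (x + s))) (c S)
  ... | no ∄s = 0 , 0∈ S , x∉ , shift
    where
    shift : ∀ s → s ∈ Carrier S → s ≢ 0 → x + s ∈ Carrier S
    shift s s∈ s≢0 with s <? c S | (S ∈?) (x + s)
    ... | _       | yes x+s∈ = x+s∈
    ... | no s≮c  | no _     = c≤⇒∈ S (≤-trans (≮⇒≥ s≮c) (m≤n+m s x))
    ... | yes s<c | no x+s∉  = contradiction (s , s<c , s∈ , s≢0 , x+s∉) ∄s
  ... | yes (s , _ , s∈ , s≢0 , x+s∉) =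
    let k , k∈ , pf = gap-below-PF d (x + s) c≤d+x+s x+s∉ in
    k + s , +-closed S k∈ s∈ ,
    subst (λ z → PseudoFrobenius S (ℤ.+ z))
      (trans (cong (k +_) (+-comm x s)) (sym (+-assoc k s x))) pf
    where
    c≤d+x+s : c S ≤ d + (x + s)
    c≤d+x+s = begin
      c S          ≤⟨ c≤d+x ⟩
      suc (d + x)  ≡⟨ +-comm 1 (d + x) ⟩
      d + x + 1    ≤⟨ +-monoʳ-≤ (d + x) (n≢0⇒n>0 s≢0) ⟩
      d + x + s    ≡⟨ +-assoc d x s ⟩
      d + (x + s)  ∎
      where open ≤-Reasoning

  1≤ν : ∀ {x} → x ∉ Carrier S → 1 ≤ ν S (ℤ.+ x)
  1≤ν {x} x∉ with gap-below-PF (c S) x (m≤m+n (c S) x) x∉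
  ... | k , k∈ , pf = filter-some (λ f → (f ℤ.- ℤ.+ x) ∈ℤ? S)
    (lose (Equivalence.from (proj₂ (proj₂ (pseudoFrobenius S)) _) pf)
      (subst (_∈ Carrierℤ S) (sym (//-rightDividesʳ (ℤ.+ x) (ℤ.+ k))) k∈))

  ∣gaps∣≤sum-ν : length (gaps S) ≤ sum (map (λ x → ν S (ℤ.+ x)) (gaps S))
  ∣gaps∣≤sum-ν = length≤sum (All.tabulate λ {x} x∈ → 1≤ν (Equivalence.to (∈gaps⇔ S x) x∈))

  -- Every number below c is in S or is a gap. This reduces Wilf's inequality to an upper bound on
  -- the number of gaps.
  c≤n+∣gaps∣ : c S ≤ n S + length (gaps S)
  c≤n+∣gaps∣ = begin
    c S                        ≡⟨ length-upTo (c S) ⟨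
    length (upTo (c S))        ≤⟨ length≤filter+filter¬ (S ∈?) (upTo (c S)) ⟩
    n S + length (filter ∉? (upTo (c S)))
      ≤⟨ +-monoʳ-≤ (n S) (unique-⊆⇒length≤ _≟_
           (Uniqueₚ.filter⁺ ∉? (Uniqueₚ.upTo⁺ (c S)))
           λ {x} x∈ → Equivalence.from (∈gaps⇔ S x) (proj₂ (∈-filter⁻ ∉? {xs = upTo (c S)} x∈))) ⟩
    n S + length (gaps S)      ∎
    where
    open ≤-Reasoning
    ∉? : Decidable (_∉ Carrier S)
    ∉? x = ¬? ((S ∈?) x)

  -- The number c is a positive element of S, so writing it as a sum of minimal generators takes at
  -- least one of them.
  0<e : 0 < e S
  0<e with proj₂ (proj₁ (proj₂ (proj₂ (minimalGenerators S)))) (c≤⇒∈ S ≤-refl)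
  ... | []    , _      , 0≡c = contradiction (trans 0≡c (+-comm (F S) 1)) 0≢1+n
  ... | _ ∷ _ , x∈ ∷ _ , _   = ∈-length x∈

  -- Both cases end here, with k = t if t < e and k = t - d otherwise. The two terms n and k n add
  -- up to (k + 1) n, and k + 1 ≤ e.
  ∣gaps∣-bound⇒Wilf : ∀ k → k < e S → length (gaps S) ≤ k * n S → c S ≤ e S * n S
  ∣gaps∣-bound⇒Wilf k k<e bound = begin
    c S                    ≤⟨ c≤n+∣gaps∣ ⟩
    n S + length (gaps S)  ≤⟨ +-monoʳ-≤ (n S) bound ⟩
    suc k * n S            ≤⟨ *-monoˡ-≤ (n S) k<e ⟩
    e S * n S              ∎
    where open ≤-Reasoning

  ∣gaps∣≤t*n : length (gaps S) ≤ t S * n S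
  ∣gaps∣≤t*n = ≤-trans ∣gaps∣≤sum-ν (≤-trans sum-ν≤sum-Λ (sum≤length* Λ≤n-PF))

  -- As Θ = Σ ν - |G| and Σ ν ≤ Σ λ, the λ-values of the first d pseudo-Frobenius numbers cancel.
  -- Each of the t - d others has λ at most n.
  Θ-bound⇒∣gaps∣-bound : ∀ d → Θ S ℤ.≥ ℤ.+ sum (map (Λ S) (take d (PF S))) →
                         length (gaps S) ≤ (t S ∸ d) * n S
  Θ-bound⇒∣gaps∣-bound d Θ≥ = begin
    length (gaps S)                 ≤⟨ +-cancelˡ-≤ low _ _ cancelled ⟩
    sum (map (Λ S) (drop d (PF S))) ≤⟨ sum≤length* (Allₚ.drop⁺ d Λ≤n-PF) ⟩
    length (drop d (PF S)) * n S    ≡⟨ cong (_* n S) (length-drop d (PF S)) ⟩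
    (t S ∸ d) * n S                 ∎
    where
    open ≤-Reasoning
    low : ℕ
    low = sum (map (Λ S) (take d (PF S)))
    cancelled : low + length (gaps S) ≤ low + sum (map (Λ S) (drop d (PF S)))
    cancelled = begin
      low + length (gaps S)
        -- Adding |G| to both sides of the bound on Θ makes both sides natural numbers, and the
        -- inequality descends from ℤ to ℕ.
        ≤⟨ ℤₚ.drop‿+≤+ (subst (ℤ._≤_ _) (sumℤ-pred (λ x → ν S (ℤ.+ x)) (gaps S))
             (ℤₚ.+-monoˡ-≤ (ℤ.+ length (gaps S)) Θ≥)) ⟩
      sum (map (λ x → ν S (ℤ.+ x)) (gaps S))    ≤⟨ sum-ν≤sum-Λ ⟩
      sum (map (Λ S) (PF S))                    ≡⟨ sum-take+drop (Λ S) d (PF S) ⟨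
      low + sum (map (Λ S) (drop d (PF S)))     ∎

proposition5p3 : (∀ (S : NumericalSemigroup) → S ≠ℕ → t S ≥ e S →
    let d = (t S + 1) ∸ e S in
    Θ S ℤ.≥ ℤ.+ sum (map (Λ S) (take d (PF S)))) →
    ∀ (S : NumericalSemigroup) → S ≠ℕ → e S * n S ≥ c S
proposition5p3 Θ≥ S S≠ℕ with e S ≤? t S
... | no e≰t  = ∣gaps∣-bound⇒Wilf S (t S) (≰⇒> e≰t) (∣gaps∣≤t*n S)
... | yes e≤t = ∣gaps∣-bound⇒Wilf S (t S ∸ d) (m∸[m+1∸n]<n (0<e S) e≤t)
  (Θ-bound⇒∣gaps∣-bound S d (Θ≥ S S≠ℕ e≤t))
  where
  d : ℕ
  d = (t S + 1) ∸ e S
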